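{- The type $\mathbf{SatMod}^2_{\mathbb T_{\mathrm{cat}}}$ of $2$-saturated models of the $\mathcal L_{\mathrm{cat}}$-theory $\mathbb T_{\mathrm{cat}}$ of categories is equivalent to the type $\mathbf{PreCat}$ of precategories.
   Context: FOLDS syntax. A FOLDS signature $\mathcal L$ is a finite inverse category; its objects are called sorts and $\mathcal L(K,K')$ denotes its hom-sets. The level of a sort is $l(K)=1$ if $K$ is the codomain only of $1_K$, and otherwise $l(K)=\sup_{f\colon K_f\to K,\ f\neq 1_K} l(K_f)+1$. Write $R>K$ if $l(R)<l(K)$. Variables are given by a functor $V\colon\mathcal L\to\mathbf{Set}$ with the $V(K)$ countably infinite and pairwise disjoint (and enough variables over every boundary). Write $x\colon K$ for $x\in V(K)$, and $x_f$ for $V(f)(x)$ when $f\in\mathcal L(K,K_f)$. Put $\mathrm{dep}(x)=\{x_f\mid \mathrm{dom}(f)=K\}$ and $\partial x=\mathrm{dep}(x)\setminus\{x\}$ (the boundary of $x$). A context is a finite subfunctor of $V$; a context morphism is a natural transformation. Formulas are built from $\top,\bot,\wedge,\vee,\rightarrow$ and quantifiers $\forall x\colon K$, $\exists x\colon K$ (a variable may be bound only if no other free variable depends on it; $\partial x$ remains free), and are taken up to $\alpha$-equivalence. A theory is a set of sentences (closed formulas). "$\forall x\colon K(\alpha)$" (and "$\exists x\colon K(\alpha)$") quantifies over a variable $x\colon K$ with $\partial x=\partial\alpha$. For $l(R)=1$, $R(\alpha)$ abbreviates $\exists\alpha\colon R.\top$. Formulas $\phi$ in context $\Gamma$ and $\psi$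 in context $\Delta$ are contextually equivalent, $\phi\sim_c\psi$, if some isomorphism of contexts $s\colon\Gamma\to\Delta$ satisfies $s(\phi)\equiv_\alpha\psi$. For a set of variables $\Gamma$, $\forall\Gamma\,\phi$ is universal closure over $\Gamma$. Indistinguishability and equivalence (syntactic). For $x\colon K$ let $\mathcal L_x$ be the set of sorts $R>K$ such that for all $q\in\mathcal L(R,K)$ and all $p_1,p_2\in\mathcal L(K,K')$, $p_1q=p_2q$ implies $x_{p_1}=x_{p_2}$. By mutual induction on level, for $x,y\colon K$ and $\alpha,\beta\colon K$: $\mathrm{Ind}(x,y)=\bigwedge_{R\in\mathcal L_x\cap\mathcal L_y}\bigwedge_{p\in\mathcal L(R,K)}\mathrm{Ind}_R^p(x,y)$, where $\mathrm{Ind}_R^p(x,y)$ is the conjunction, taking one representative up to $\sim_c$, of all formulas $\forall\Gamma_{\alpha,\beta}\,R(\alpha)\simeq R(\beta)$ with $\alpha,\beta\colon R$, $\alpha_p=x$, $\beta_p=y$, $\alpha_q=\beta_q$ for all $q\in\mathcal L(R,K)$ with $q\ne p$, and $\Gamma_{\alpha,\beta}=(\partial\alpha\cup\partial\beta)\setminus(\mathrm{dep}(\alpha_p)\cup\mathrm{dep}(\beta_p))$; when $\partial x=\partial y$ write $x\cong y$ for $\mathrm{Ind}(x,y)$; and $K(\alpha)\simeq K(\beta)$ is $[\forall x\colon K(\alpha)\,\exists y\colon K(\beta).\,\mathrm{Ind}(x,y)\wedge(\forall y'\colon K(\beta).\,\mathrm{Ind}(x,y')\to y\cong y')]\wedge[\forall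 x,x'\colon K(\alpha)\,\forall y,y'\colon K(\beta).\,\mathrm{Ind}(x,y)\wedge\mathrm{Ind}(x',y')\wedge y\cong y'\to x\cong x']\wedge[\forall y\colon K(\beta)\,\exists x\colon K(\alpha).\,\mathrm{Ind}(x,y)]$. Type theory. We work in Homotopy Type Theory with a univalent universe $\mathcal U$. The type $\mathbf{Str}_{\mathcal L}$ of $\mathcal L$-structures is the $\Sigma$-type extracted from $\mathcal L$ by induction on level, in which each sort is a $\mathcal U$-valued type family over its boundary; $K^{\mathcal M}$ is the interpretation of $K$ in $\mathcal M$, and $\Gamma^{\mathcal M}$ the interpretation of a context $\Gamma$. Formulas are interpreted by propositions-as-types with $\exists$ and $\vee$ propositionally truncated; a $\mathbb T$-model is an $\mathcal L$-structure satisfying all sentences of $\mathbb T$. However, $\mathrm{Ind}$, $\cong$ and $\simeq$ are interpreted in $\mathcal M$ with untruncated existentials: $\mathrm{Ind}^{\mathcal M}(x,y)$ is the finite product over $R\in\mathcal L_x\cap\mathcal L_y$, $p\in\mathcal L(R,K)$ and the pairs $(\alpha,\beta)$ (up to $\sim_c$ of the formulas $\forall\Gamma_{\alpha,\beta}\,R(\alpha)\simeq R(\beta)$) with $\alpha,\beta\colon R$, $\alpha_p=x$, $\beta_p=y$ and $\alpha_q=\beta_q$ for all $q\in\mathcal L(R,K)$ with $q\ne p$, of $\prod_{\mathbf z\colon\Gamma^{\mathcal M}_{\alpha,\beta}}R(\alpha)\simeq^{\mathcal M}R(\beta)$, where $\Gamma_{\alpha,\beta}=(\partial\alpha\cup\partial\beta)\setminus(\mathrm{dep}(\alpha_p)\cup\mathrm{dep}(\beta_p))$;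 $x\cong^{\mathcal M}y$ is $\mathrm{Ind}^{\mathcal M}(x,y)$ when $\partial x=\partial y$; and $K(\alpha)\simeq^{\mathcal M}K(\beta)$ is $\big[\prod_{x\colon K^{\mathcal M}(\alpha)}\sum_{y\colon K^{\mathcal M}(\beta)}\mathrm{Ind}^{\mathcal M}(x,y)\times\prod_{y'\colon K^{\mathcal M}(\beta)}(\mathrm{Ind}^{\mathcal M}(x,y')\to y\cong^{\mathcal M}y')\big]\times\big[\prod_{x,x'\colon K^{\mathcal M}(\alpha)}\prod_{y,y'\colon K^{\mathcal M}(\beta)}(\mathrm{Ind}^{\mathcal M}(x,y)\times\mathrm{Ind}^{\mathcal M}(x',y')\times y\cong^{\mathcal M}y'\to x\cong^{\mathcal M}x')\big]\times\big[\prod_{y\colon K^{\mathcal M}(\beta)}\sum_{x\colon K^{\mathcal M}(\alpha)}\mathrm{Ind}^{\mathcal M}(x,y)\big]$. The relation $\cong^{\mathcal M}$ is reflexive, giving by identity induction a map $\mathtt{idtoiso}_{x,y}\colon (x=y)\to(x\cong^{\mathcal M}y)$. In a context $\Gamma^{\mathcal M}$ with $\Gamma$ appropriate to $K$, saturation for $K^{\mathcal M}$ is the proposition $\prod_{x,y\colon K^{\mathcal M}}\mathtt{isequiv}(\mathtt{idtoiso}_{x,y})$. $\mathcal M$ is $K$-saturated if this is inhabited, and $n$-saturated if it is $K$-saturated for all sorts with $l(K)\le n$. $\mathbf{SatMod}^n_{\mathbb T}$ is the type of $n$-saturated $\mathbb T$-models. Categories. $\mathcal L_{\mathrm{cat}}$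 has sorts $O$ (level $3$), $A$ (level $2$), and $\circ, I, =_A$ (level $1$), generated by arrows $d,c\colon A\to O$, $i\colon I\to A$, $s,t\colon {=_A}\to A$, $t_0,t_1,t_2\colon\circ\to A$ subject to $di=ci$, $ds=dt$, $cs=ct$, $dt_0=dt_2$, $ct_1=ct_2$, $dt_1=ct_0$. Write $A(x,y)$ for arrows with $d$-component $x$ and $c$-component $y$, and $\circ(f,g,h)$ for the sort with $t_0,t_1,t_2$ components $f,g,h$ ("$h$ is $f$ followed by $g$"). $\mathbb T_{\mathrm{cat}}$ is the usual theory of categories in relational form: $=_A$ is an equivalence relation on each $A(x,y)$ and a congruence for $I$ and $\circ$; every composable $f,g$ has a composite $h$ with $\circ(f,g,h)$, unique up to $=_A$; every $x$ has some $j\colon A(x,x)$ with $I(j)$; such $j$ are left and right units for $\circ$; and $\circ$ is associative. $\mathbf{PreCat}$ is the type of precategories in the sense of the HoTT book (type of objects in $\mathcal U$, hom-sets, identities and composition satisfying unit and associativity laws; objects form an arbitrary type). -}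

{-# OPTIONS --without-K #-}

module Defs where

open import Level using (Level; _⊔_; Setω) renaming (suc to lsuc; zero to lzero)
open import Data.Nat using (ℕ; zero; suc; _≤_; _<_; z≤n; s≤s)
open import Data.Nat.Properties using (≤-trans; ≤-refl)
open import Data.List using (List; []; _∷_; _++_)
open import Data.List.Relation.Unary.All using (All)
open import Data.Product using (Σ; _×_; _,_; proj₁; proj₂; Σ-syntax)
open import Data.Product.Properties using (,-injectiveʳ-UIP; ≡-dec)
open import Data.Sum using (_⊎_; inj₁; inj₂)
open import Data.Empty using (⊥)
open import Data.Unit.Polymorphic using (⊤; tt)
import Data.Empty.Polymorphic as Emp
open import Relation.Nullary using (yes; no)
open import Relation.Binary.Definitions using (DecidableEquality)
open import Relation.Binary.PropositionalEquality
  using (_≡_; _≢_; refl; sym; trans; cong; subst)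
open import Axiom.UniquenessOfIdentityProofs using (UIP; module Decidable⇒UIP)

private variable
  ℓ ℓ′ : Level

isContr : Set ℓ → Set ℓ
isContr X = Σ[ c ∈ X ] (∀ x → c ≡ x)

isProp : Set ℓ → Set ℓ
isProp X = (x y : X) → x ≡ y

isSet : Set ℓ → Set ℓ
isSet X = (x y : X) → isProp (x ≡ y)

isEquiv : {X : Set ℓ} {Y : Set ℓ′} → (X → Y) → Set _
isEquiv {X = X} {Y} f = (y : Y) → isContr (Σ[ x ∈ X ] f x ≡ y)

infix 4 _≃_
_≃_ : Set ℓ → Set ℓ′ → Set _
X ≃ Y = Σ (X → Y) isEquiv

id-≃ : (X : Set ℓ) → X ≃ X
id-≃ X = (λ x → x) , λ y → (y , refl) , λ { (_ , refl) → refl }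

idtoeqv : {X Y : Set ℓ} → X ≡ Y → X ≃ Y
idtoeqv refl = id-≃ _

Univalence : (ℓ : Level) → Set (lsuc ℓ)
Univalence ℓ = (X Y : Set ℓ) → isEquiv (idtoeqv {X = X} {Y})

record PropTrunc : Setω where
  field
    ∥_∥    : Set ℓ → Set ℓ
    ∣_∣    : {X : Set ℓ} → X → ∥ X ∥
    ∥∥-prop : {X : Set ℓ} → isProp ∥ X ∥
    ∥∥-rec  : {X : Set ℓ} {Y : Set ℓ′} → isProp Y → (X → Y) → ∥ X ∥ → Y

-- E is the sort =_A and C is the sort ∘.

data Sort : Set where
  O A I E C : Sort

l : Sort → ℕ
l O = 3
l A = 2
l I = 1
l E = 1
l C = 1

-- The non-identity arrows.  The composites with codomain O are
--   di = d i = c i,  ds = d s = d t,  cs = c s = c t,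
--   dt₀ = d t₀ = d t₂,  ct₀ = c t₀ = d t₁,  ct₁ = c t₁ = c t₂.

infix 4 _⇾_
data _⇾_ : Sort → Sort → Set where
  d c         : A ⇾ O
  i           : I ⇾ A
  di          : I ⇾ O
  s t         : E ⇾ A
  ds cs       : E ⇾ O
  t₀ t₁ t₂    : C ⇾ A
  dt₀ ct₀ ct₁ : C ⇾ O

data 𝓛 : Sort → Sort → Set where
  𝟙   : ∀ {K} → 𝓛 K K
  [_] : ∀ {K K'} → K ⇾ K' → 𝓛 K K'

comp⁺ : ∀ {K K' K''} → K' ⇾ K'' → K ⇾ K' → K ⇾ K''
comp⁺ d i  = di
comp⁺ d s  = ds
comp⁺ d t  = ds
comp⁺ d t₀ = dt₀
comp⁺ d t₁ = ct₀
comp⁺ d t₂ = dt₀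
comp⁺ c i  = di
comp⁺ c s  = cs
comp⁺ c t  = cs
comp⁺ c t₀ = ct₀
comp⁺ c t₁ = ct₁
comp⁺ c t₂ = ct₁

infixr 9 _∘_
_∘_ : ∀ {K K' K''} → 𝓛 K' K'' → 𝓛 K K' → 𝓛 K K''
𝟙     ∘ q     = q
[ p ] ∘ 𝟙     = [ p ]
[ p ] ∘ [ q ] = [ comp⁺ p q ]

-- Bd is the type of boundaries of each sort, given the interpretations of O
-- and A.  In a structure each sort is a family over its boundary.

data Bd (Ob : Set ℓ) (Ar : Ob → Ob → Set ℓ) : Sort → Set ℓ where
  ∂O : Bd Ob Ar O
  ∂A : (x y : Ob) → Bd Ob Ar A
  ∂I : {x : Ob} → Ar x x → Bd Ob Ar I
  ∂E : {x y : Ob} → Ar x y → Ar x y → Bd Ob Ar E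
  ∂C : {x y z : Ob} → Ar x y → Ar y z → Ar x z → Bd Ob Ar C

record Str (ℓ : Level) : Set (lsuc ℓ) where
  field
    Ob : Set ℓ
    Ar : Ob → Ob → Set ℓ
    Id : (x : Ob) → Ar x x → Set ℓ
    Eq : (x y : Ob) → Ar x y → Ar x y → Set ℓ
    Co : (x y z : Ob) → Ar x y → Ar y z → Ar x z → Set ℓ

∂ : Str ℓ → Sort → Set ℓ
∂ S = Bd (Str.Ob S) (Str.Ar S)

Fib : (S : Str ℓ) {K : Sort} → ∂ S K → Set ℓ
Fib S ∂O         = Str.Ob S
Fib S (∂A x y)   = Str.Ar S x y
Fib S (∂I f)     = Str.Id S _ f
Fib S (∂E f g)   = Str.Eq S _ _ f g
Fib S (∂C f g h) = Str.Co S _ _ _ f g h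

El : Str ℓ → Sort → Set ℓ
El S K = Σ (∂ S K) (Fib S)

-- α ↾ q is α_q, and x ⇂ f is x_f.

module Restriction (S : Str ℓ) where

  infixl 20 _↾_ _⇂_
  _↾_ : {K K' : Sort} → ∂ S K → K ⇾ K' → El S K'
  ∂A x y                 ↾ d   = ∂O , x
  ∂A x y                 ↾ c   = ∂O , y
  ∂I f                   ↾ i   = ∂A _ _ , f
  ∂I {x} f               ↾ di  = ∂O , x
  ∂E f g                 ↾ s   = ∂A _ _ , f
  ∂E f g                 ↾ t   = ∂A _ _ , g
  ∂E {x} {y} f g         ↾ ds  = ∂O , x
  ∂E {x} {y} f g         ↾ cs  = ∂O , y
  ∂C f g h               ↾ t₀  = ∂A _ _ , f
  ∂C f g h               ↾ t₁  = ∂A _ _ , g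
  ∂C f g h               ↾ t₂  = ∂A _ _ , h
  ∂C {x} {y} {z} f g h   ↾ dt₀ = ∂O , x
  ∂C {x} {y} {z} f g h   ↾ ct₀ = ∂O , y
  ∂C {x} {y} {z} f g h   ↾ ct₁ = ∂O , z

  _⇂_ : {K K' : Sort} → El S K → 𝓛 K K' → El S K'
  x ⇂ 𝟙 = x
  (b , _) ⇂ [ f ] = b ↾ f

  _∈∂_ : {K K' : Sort} → El S K' → ∂ S K → Set ℓ
  v ∈∂ α = Σ[ q ∈ _ ⇾ _ ] α ↾ q ≡ v

  _∈dep_ : {K K' : Sort} → El S K' → El S K → Set ℓ
  v ∈dep x = Σ[ f ∈ 𝓛 _ _ ] x ⇂ f ≡ v

record _⇒_ (S : Str ℓ) (S' : Str ℓ′) : Set (ℓ ⊔ ℓ′) where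
  private
    module S  = Str S
    module S' = Str S'
  field
    ob : S.Ob → S'.Ob
    ar : ∀ {x y} → S.Ar x y → S'.Ar (ob x) (ob y)
    id : ∀ {x f} → S.Id x f → S'.Id (ob x) (ar f)
    eq : ∀ {x y f g} → S.Eq x y f g → S'.Eq (ob x) (ob y) (ar f) (ar g)
    co : ∀ {x y z f g h} → S.Co x y z f g h →
         S'.Co (ob x) (ob y) (ob z) (ar f) (ar g) (ar h)

  ∂⟨_⟩ : ∀ {K} → ∂ S K → ∂ S' K
  ∂⟨ ∂O ⟩       = ∂O
  ∂⟨ ∂A x y ⟩   = ∂A (ob x) (ob y)
  ∂⟨ ∂I f ⟩     = ∂I (ar f)
  ∂⟨ ∂E f g ⟩   = ∂E (ar f) (ar g)
  ∂⟨ ∂C f g h ⟩ = ∂C (ar f) (ar g) (ar h)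

  el : ∀ {K} → El S K → El S' K
  el (∂O , x)       = ∂O , ob x
  el (∂A x y , f)   = ∂A _ _ , ar f
  el (∂I f , u)     = ∂I _ , id u
  el (∂E f g , u)   = ∂E _ _ , eq u
  el (∂C f g h , u) = ∂C _ _ _ , co u

open _⇒_ public using (∂⟨_⟩; el)

id⇒ : {S : Str ℓ} → S ⇒ S
id⇒ = record
  { ob = λ x → x ; ar = λ f → f ; id = λ u → u ; eq = λ u → u ; co = λ u → u }

_∘⇒_ : {S S' S'' : Str ℓ} → S' ⇒ S'' → S ⇒ S' → S ⇒ S''
g ∘⇒ f = record
  { ob = λ x → g.ob (f.ob x) ; ar = λ u → g.ar (f.ar u) ; id = λ u → g.id (f.id u)
  ; eq = λ u → g.eq (f.eq u) ; co = λ u → g.co (f.co u) }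
  where
  module f = _⇒_ f
  module g = _⇒_ g

-- S ⊕ b freely adjoins to S one element over the boundary b.

module _ (S : Str ℓ) {K : Sort} (b : ∂ S K) where
  open Str S

  isAt : {K' : Sort} → ∂ S K' → Set ℓ
  isAt {K'} b' = _≡_ {A = Σ Sort (∂ S)} (K , b) (K' , b')

  data Ob⁺ : Set ℓ where
    here  : isAt ∂O → Ob⁺
    there : Ob → Ob⁺

  data Ar⁺ : Ob⁺ → Ob⁺ → Set ℓ where
    here  : ∀ {x y} → isAt (∂A x y) → Ar⁺ (there x) (there y)
    there : ∀ {x y} → Ar x y → Ar⁺ (there x) (there y)

  data Id⁺ : (x : Ob⁺) → Ar⁺ x x → Set ℓ where
    here  : ∀ {x} {f : Ar x x} → isAt (∂I f) → Id⁺ (there x) (there f)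
    there : ∀ {x f} → Id x f → Id⁺ (there x) (there f)

  data Eq⁺ : (x y : Ob⁺) → Ar⁺ x y → Ar⁺ x y → Set ℓ where
    here  : ∀ {x y} {f g : Ar x y} → isAt (∂E f g) →
            Eq⁺ (there x) (there y) (there f) (there g)
    there : ∀ {x y f g} → Eq x y f g → Eq⁺ (there x) (there y) (there f) (there g)

  data Co⁺ : (x y z : Ob⁺) → Ar⁺ x y → Ar⁺ y z → Ar⁺ x z → Set ℓ where
    here  : ∀ {x y z} {f : Ar x y} {g : Ar y z} {h : Ar x z} → isAt (∂C f g h) →
            Co⁺ (there x) (there y) (there z) (there f) (there g) (there h)
    there : ∀ {x y z f g h} → Co x y z f g h →
            Co⁺ (there x) (there y) (there z) (there f) (there g) (there h)

  _⊕_ : Str ℓ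
  _⊕_ = record { Ob = Ob⁺ ; Ar = Ar⁺ ; Id = Id⁺ ; Eq = Eq⁺ ; Co = Co⁺ }

  ι : S ⇒ _⊕_
  ι = record { ob = there ; ar = there ; id = there ; eq = there ; co = there }

top : {S : Str ℓ} {K : Sort} (b : ∂ S K) → El (S ⊕ b) K
top ∂O         = ∂O , here refl
top (∂A x y)   = ∂A _ _ , here refl
top (∂I f)     = ∂I _ , here refl
top (∂E f g)   = ∂E _ _ , here refl
top (∂C f g h) = ∂C _ _ _ , here refl

extend : {S : Str ℓ} {M : Str ℓ′} (h : S ⇒ M) {K : Sort} (b : ∂ S K) →
         Fib M (∂⟨ h ⟩ b) → (S ⊕ b) ⇒ M
extend {S = S} {M} h {K} b a = record { ob = ob ; ar = ar ; id = id ; eq = eq ; co = co }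
  where
  module S = Str (S ⊕ b)
  module M = Str M
  module h = _⇒_ h
  ob : S.Ob → M.Ob
  ob (here refl) = a
  ob (there x)   = h.ob x
  ar : ∀ {x y} → S.Ar x y → M.Ar (ob x) (ob y)
  ar (here refl) = a
  ar (there f)   = h.ar f
  id : ∀ {x f} → S.Id x f → M.Id (ob x) (ar f)
  id (here refl) = a
  id (there u)   = h.id u
  eq : ∀ {x y f g} → S.Eq x y f g → M.Eq (ob x) (ob y) (ar f) (ar g)
  eq (here refl) = a
  eq (there u)   = h.eq u
  co : ∀ {x y z f g h} → S.Co x y z f g h →
       M.Co (ob x) (ob y) (ob z) (ar f) (ar g) (ar h)
  co (here refl) = a
  co (there u)   = h.co u

-- Contexts, presented as telescopes.  The variables of a context Γ form the
-- finite structure Vars Γ, which is Γ as a functor on 𝓛, and a variable x : K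
-- of Γ is an element of El (Vars Γ) K.  Variables are addressed by position,
-- so that α-equivalence is identity, and a fresh variable over any boundary
-- in Γ is always available.

infixl 5 _▹_
data Ctx : Set
Vars : Ctx → Str lzero

data Ctx where
  ∅   : Ctx
  _▹_ : (Γ : Ctx) {K : Sort} → ∂ (Vars Γ) K → Ctx

Vars ∅ = record
  { Ob = ⊥ ; Ar = λ _ _ → ⊥ ; Id = λ _ _ → ⊥ ; Eq = λ _ _ _ _ → ⊥
  ; Co = λ _ _ _ _ _ _ → ⊥ }
Vars (Γ ▹ b) = Vars Γ ⊕ b

-- ⟦ Γ ⟧ M is the interpretation of Γ, and lk Γ γ is the morphism from the
-- variables of Γ to M that γ determines.

⟦_⟧ : Ctx → Str ℓ → Set ℓ
lk  : {M : Str ℓ} (Γ : Ctx) → ⟦ Γ ⟧ M → Vars Γ ⇒ M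

⟦ ∅ ⟧ M     = ⊤
⟦ Γ ▹ b ⟧ M = Σ[ γ ∈ ⟦ Γ ⟧ M ] Fib M (∂⟨ lk Γ γ ⟩ b)

lk ∅       γ       = record
  { ob = λ () ; ar = λ { {()} } ; id = λ { {()} } ; eq = λ { {()} } ; co = λ { {()} } }
lk (Γ ▹ b) (γ , a) = extend (lk Γ γ) b a

infixr 4 _⇒'_
infixr 5 _∨'_
infixr 6 _∧'_
data Formula (Γ : Ctx) : Set where
  ⊤' ⊥'           : Formula Γ
  _∧'_ _∨'_ _⇒'_  : Formula Γ → Formula Γ → Formula Γ
  ∀' ∃'           : {K : Sort} (b : ∂ (Vars Γ) K) → Formula (Γ ▹ b) → Formula Γ

Sentence : Set
Sentence = Formula ∅

Theory : Set
Theory = List Sentence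

∀* : (Γ : Ctx) → Formula Γ → Sentence
∀* ∅       φ = φ
∀* (Γ ▹ b) φ = ∀* Γ (∀' b φ)

pattern v0 = here refl
pattern v1 = there v0
pattern v2 = there v1
pattern v3 = there v2
pattern v4 = there v3
pattern v5 = there v4
pattern v6 = there v5
pattern v7 = there v6
pattern v8 = there v7

module _ {Γ : Ctx} where
  open Str (Vars Γ)

  infix 7 _≈_
  _≈_ : {x y : Ob} → Ar x y → Ar x y → Formula Γ
  f ≈ g = ∃' (∂E f g) ⊤'

  isId : {x : Ob} → Ar x x → Formula Γ
  isId f = ∃' (∂I f) ⊤'

  isComp : {x y z : Ob} → Ar x y → Ar y z → Ar x z → Formula Γ
  isComp f g h = ∃' (∂C f g h) ⊤'

-- Each comment lists the variables of the context from the outermost to the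
-- innermost, so that the last one listed is v0.

𝕋cat : Theory
𝕋cat =
  -- x y ; f
    ∀* (∅ ▹ ∂O ▹ ∂O ▹ ∂A v1 v0)
       (v0 ≈ v0)
  -- x y ; f g
  ∷ ∀* (∅ ▹ ∂O ▹ ∂O ▹ ∂A v1 v0 ▹ ∂A v2 v1)
       (v1 ≈ v0 ⇒' v0 ≈ v1)
  -- x y ; f g h
  ∷ ∀* (∅ ▹ ∂O ▹ ∂O ▹ ∂A v1 v0 ▹ ∂A v2 v1 ▹ ∂A v3 v2)
       (v2 ≈ v1 ∧' v1 ≈ v0 ⇒' v2 ≈ v0)
  -- x ; f g : A(x,x)
  ∷ ∀* (∅ ▹ ∂O ▹ ∂A v0 v0 ▹ ∂A v1 v1)
       (v1 ≈ v0 ∧' isId v1 ⇒' isId v0)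
  -- x y z ; f f' : A(x,y) ; g g' : A(y,z) ; h h' : A(x,z)
  ∷ ∀* (∅ ▹ ∂O ▹ ∂O ▹ ∂O
          ▹ ∂A v2 v1 ▹ ∂A v3 v2 ▹ ∂A v3 v2 ▹ ∂A v4 v3 ▹ ∂A v6 v4 ▹ ∂A v7 v5)
       (v5 ≈ v4 ∧' v3 ≈ v2 ∧' v1 ≈ v0 ∧' isComp v5 v3 v1 ⇒' isComp v4 v2 v0)
  -- x y z ; f : A(x,y) ; g : A(y,z)
  ∷ ∀* (∅ ▹ ∂O ▹ ∂O ▹ ∂O ▹ ∂A v2 v1 ▹ ∂A v2 v1)
       (∃' (∂A v4 v2) (isComp v2 v1 v0))
  -- x y z ; f : A(x,y) ; g : A(y,z) ; h h' : A(x,z)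
  ∷ ∀* (∅ ▹ ∂O ▹ ∂O ▹ ∂O ▹ ∂A v2 v1 ▹ ∂A v2 v1 ▹ ∂A v4 v2 ▹ ∂A v5 v3)
       (isComp v3 v2 v1 ∧' isComp v3 v2 v0 ⇒' v1 ≈ v0)
  -- x
  ∷ ∀* (∅ ▹ ∂O)
       (∃' (∂A v0 v0) (isId v0))
  -- x y ; j : A(x,x) ; f : A(x,y)
  ∷ ∀* (∅ ▹ ∂O ▹ ∂O ▹ ∂A v1 v1 ▹ ∂A v2 v1)
       (isId v1 ⇒' isComp v1 v0 v0)
  -- x y ; j : A(y,y) ; f : A(x,y)
  ∷ ∀* (∅ ▹ ∂O ▹ ∂O ▹ ∂A v0 v0 ▹ ∂A v2 v1)
       (isId v1 ⇒' isComp v0 v1 v0)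
  -- w x y z ; f : A(w,x) ; g : A(x,y) ; h : A(y,z) ;
  -- p : A(w,y) ; q : A(x,z) ; k : A(w,z)
  ∷ ∀* (∅ ▹ ∂O ▹ ∂O ▹ ∂O ▹ ∂O
          ▹ ∂A v3 v2 ▹ ∂A v3 v2 ▹ ∂A v3 v2 ▹ ∂A v6 v4 ▹ ∂A v6 v4 ▹ ∂A v8 v5)
       (isComp v5 v4 v2 ∧' isComp v4 v3 v1 ∧' isComp v2 v3 v0 ⇒' isComp v5 v1 v0)
  ∷ []

module _ (tr : PropTrunc) (M : Str ℓ) where
  open PropTrunc tr

  ⟦_⟧ᶠ : {Γ : Ctx} → Formula Γ → ⟦ Γ ⟧ M → Set ℓ
  ⟦ ⊤' ⟧ᶠ     γ = ⊤
  ⟦ ⊥' ⟧ᶠ     γ = Emp.⊥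
  ⟦ φ ∧' ψ ⟧ᶠ γ = ⟦ φ ⟧ᶠ γ × ⟦ ψ ⟧ᶠ γ
  ⟦ φ ∨' ψ ⟧ᶠ γ = ∥ ⟦ φ ⟧ᶠ γ ⊎ ⟦ ψ ⟧ᶠ γ ∥
  ⟦ φ ⇒' ψ ⟧ᶠ γ = ⟦ φ ⟧ᶠ γ → ⟦ ψ ⟧ᶠ γ
  ⟦ ∀' b φ ⟧ᶠ γ = (a : Fib M (∂⟨ lk _ γ ⟩ b)) → ⟦ φ ⟧ᶠ (γ , a)
  ⟦ ∃' b φ ⟧ᶠ γ = ∥ (Σ[ a ∈ Fib M (∂⟨ lk _ γ ⟩ b) ] ⟦ φ ⟧ᶠ (γ , a)) ∥

  IsModel : Theory → Set ℓ
  IsModel = All (λ φ → ⟦ φ ⟧ᶠ tt)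

-- ⟦ e ⟧⁺ γ is the interpretation, over γ, of the variables added by e.

infix 4 _⊑_
data _⊑_ (Γ : Ctx) : Ctx → Set where
  stop : Γ ⊑ Γ
  _▹_  : ∀ {Γ' K} → Γ ⊑ Γ' → (b : ∂ (Vars Γ') K) → Γ ⊑ (Γ' ▹ b)

wk* : ∀ {Γ Γ'} → Γ ⊑ Γ' → Vars Γ ⇒ Vars Γ'
wk* stop    = id⇒
wk* (e ▹ b) = ι _ b ∘⇒ wk* e

module _ {M : Str ℓ} {Γ : Ctx} where

  ⟦_⟧⁺      : ∀ {Γ'} → Γ ⊑ Γ' → ⟦ Γ ⟧ M → Set ℓ
  extendEnv : ∀ {Γ'} (e : Γ ⊑ Γ') (γ : ⟦ Γ ⟧ M) → ⟦ e ⟧⁺ γ → ⟦ Γ' ⟧ M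

  ⟦ stop ⟧⁺  γ = ⊤
  ⟦ e ▹ b ⟧⁺ γ = Σ[ z ∈ ⟦ e ⟧⁺ γ ] Fib M (∂⟨ lk _ (extendEnv e γ z) ⟩ b)

  extendEnv stop    γ z       = γ
  extendEnv (e ▹ b) γ (z , a) = extendEnv e γ z , a

-- R ∈𝓛 x states that R belongs to 𝓛_x.

module _ (S : Str ℓ) {K : Sort} where
  open Restriction S

  _∈𝓛_ : Sort → El S K → Set ℓ
  R ∈𝓛 x =
    l R < l K ×
    ((q : 𝓛 R K) {K' : Sort} (p₁ p₂ : 𝓛 K K') → p₁ ∘ q ≡ p₂ ∘ q → x ⇂ p₁ ≡ x ⇂ p₂)

len : Ctx → ℕ
len ∅       = 0
len (Γ ▹ b) = suc (len Γ)

-- The number of a variable is its position in the context, counted from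
-- the outermost one.

module _ where
  open Str

  numO : (Γ : Ctx) → Ob (Vars Γ) → ℕ
  numO (Γ ▹ b) (here _)  = len Γ
  numO (Γ ▹ b) (there x) = numO Γ x

  numA : (Γ : Ctx) {x y : Ob (Vars Γ)} → Ar (Vars Γ) x y → ℕ
  numA (Γ ▹ b) (here _)  = len Γ
  numA (Γ ▹ b) (there f) = numA Γ f

nums : (Γ : Ctx) {K : Sort} → ∂ (Vars Γ) K → List ℕ
nums Γ ∂O                     = []
nums Γ (∂A x y)               = numO Γ x ∷ numO Γ y ∷ []
nums Γ (∂I {x} f)             = numO Γ x ∷ numA Γ f ∷ []
nums Γ (∂E {x} {y} f g)       = numO Γ x ∷ numO Γ y ∷ numA Γ f ∷ numA Γ g ∷ []
nums Γ (∂C {x} {y} {z} f g h) =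
  numO Γ x ∷ numO Γ y ∷ numO Γ z ∷ numA Γ f ∷ numA Γ g ∷ numA Γ h ∷ []

-- InOrder m n ks : the numbers k with m ≤ k < n all occur in ks, their
-- first occurrences are in increasing order, and no k ≥ n occurs.

InOrder : ℕ → ℕ → List ℕ → Set
InOrder m n []       = m ≡ n
InOrder m n (k ∷ ks) = (k < m × InOrder m n ks) ⊎ (k ≡ m × InOrder (suc m) n ks)

-- The pairs (α , β) indexing Ind_R^p(x,y), one for each ∼_c-class of the
-- formulas ∀ Γ_{α,β} R(α) ≃ R(β).  These formulas have the free variables
-- dep(x) ∪ dep(y); a context isomorphism relating two of them fixes x and y,
-- hence dep(x) ∪ dep(y), and so only renames Γ_{α,β}.  The variables of
-- Γ_{α,β} are those that ext adds; the representative of a class is the pair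
-- in which they are introduced in the order of their first occurrence in
-- (α , β).  Only ∂α and ∂β matter, so α and β are given by their boundaries.

record Pair (Γ : Ctx) {R K : Sort} (p : R ⇾ K) (x y : El (Vars Γ) K) : Set where
  open Restriction
  field
    Γ'        : Ctx
    ext       : Γ ⊑ Γ'
    α β       : ∂ (Vars Γ') R
    α-at-p    : _↾_ (Vars Γ') α p ≡ el (wk* ext) x
    β-at-p    : _↾_ (Vars Γ') β p ≡ el (wk* ext) y
    elsewhere : (q : R ⇾ K) → q ≢ p → _↾_ (Vars Γ') α q ≡ _↾_ (Vars Γ') β q
    -- The variables of ∂α ∪ ∂β that are not added by ext lie in dep(x) ∪ dep(y).
    .old      : {K' : Sort} (v : El (Vars Γ) K') →
                _∈∂_ (Vars Γ') (el (wk* ext) v) α ⊎ _∈∂_ (Vars Γ') (el (wk* ext) v) β →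
                _∈dep_ (Vars Γ) v x ⊎ _∈dep_ (Vars Γ) v y
    .new      : InOrder (len Γ) (len Γ') (nums Γ' α ++ nums Γ' β)

module _ {M : Str ℓ} where

  -- An element of the fibre over β, in the interpretation of Γ ▹ α.

  shift : (Γ : Ctx) {K K' : Sort} (α : ∂ (Vars Γ) K) (β : ∂ (Vars Γ) K') {γ : ⟦ Γ ⟧ M}
          {u : Fib M (∂⟨ lk Γ γ ⟩ α)} → Fib M (∂⟨ lk Γ γ ⟩ β) →
          Fib M (∂⟨ lk (Γ ▹ α) (γ , u) ⟩ (∂⟨ ι (Vars Γ) α ⟩ β))
  shift Γ α ∂O         v = v
  shift Γ α (∂A x y)   v = v
  shift Γ α (∂I f)     v = v
  shift Γ α (∂E f g)   v = v
  shift Γ α (∂C f g h) v = v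

  -- Ind n Γ x y γ is Ind(x,y), and Equi n Γ α β γ is K(α) ≃ K(β), at γ.  The
  -- recursion is on an upper bound n for l(K), so that the value of Ind at 0,
  -- which is below every level, is immaterial; l(K) itself is used below.
  -- Ind₂ n Γ α β γ u v is Ind(x,y) at (γ , u , v) for x : K(α), y : K(β) fresh.

  Ind  : ℕ → (Γ : Ctx) {K : Sort} (x y : El (Vars Γ) K) → ⟦ Γ ⟧ M → Set ℓ
  Equi : ℕ → (Γ : Ctx) {K : Sort} (α β : ∂ (Vars Γ) K) → ⟦ Γ ⟧ M → Set ℓ
  Ind₂ : ℕ → (Γ : Ctx) {K : Sort} (α β : ∂ (Vars Γ) K) (γ : ⟦ Γ ⟧ M) →
         Fib M (∂⟨ lk Γ γ ⟩ α) → Fib M (∂⟨ lk Γ γ ⟩ β) → Set ℓ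

  Ind zero    Γ x y γ = ⊤
  Ind (suc n) Γ {K} x y γ =
    (R : Sort) → _∈𝓛_ (Vars Γ) R x → _∈𝓛_ (Vars Γ) R y →
    (p : R ⇾ K) (P : Pair Γ p x y) →
    let open Pair P in
    (z : ⟦ ext ⟧⁺ γ) → Equi n Γ' α β (extendEnv ext γ z)

  Ind₂ n Γ α β γ u v =
    Ind n (Γ ▹ α ▹ ∂⟨ ι _ α ⟩ β) (el (ι _ (∂⟨ ι _ α ⟩ β)) (top α)) (top (∂⟨ ι _ α ⟩ β))
        ((γ , u) , shift Γ α β v)

  Equi n Γ α β γ =
    ((x : Kα) → Σ[ y ∈ Kβ ]
       Ind₂ n Γ α β γ x y × ((y' : Kβ) → Ind₂ n Γ α β γ x y' → Ind₂ n Γ β β γ y y'))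
    × ((x x' : Kα) (y y' : Kβ) →
       Ind₂ n Γ α β γ x y × Ind₂ n Γ α β γ x' y' × Ind₂ n Γ β β γ y y' →
       Ind₂ n Γ α α γ x x')
    × ((y : Kβ) → Σ[ x ∈ Kα ] Ind₂ n Γ α β γ x y)
    where
    Kα = Fib M (∂⟨ lk Γ γ ⟩ α)
    Kβ = Fib M (∂⟨ lk Γ γ ⟩ β)

1≤l : (K : Sort) → 1 ≤ l K
1≤l O = s≤s z≤n
1≤l A = s≤s z≤n
1≤l I = s≤s z≤n
1≤l E = s≤s z≤n
1≤l C = s≤s z≤n

Ob-≟ : (Γ : Ctx) → DecidableEquality (Str.Ob (Vars Γ))
Ob-≟ (Γ ▹ ∂O) (here refl) (here refl) = yes refl
Ob-≟ (Γ ▹ b)  (here _)    (there y)   = no λ ()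
Ob-≟ (Γ ▹ b)  (there x)   (here _)    = no λ ()
Ob-≟ (Γ ▹ b)  (there x)   (there y) with Ob-≟ Γ x y
... | yes refl = yes refl
... | no  x≢y  = no λ { refl → x≢y refl }

module _ {S : Str ℓ} (_≟_ : DecidableEquality (Str.Ob S)) where
  open Str S
  open Restriction S

  private
    ends : El S A → Σ[ xy ∈ Ob × Ob ] Ar (proj₁ xy) (proj₂ xy)
    ends (∂A x y , f) = (x , y) , f

    uip² : UIP (Ob × Ob)
    uip² = Decidable⇒UIP.≡-irrelevant (≡-dec _≟_ _≟_)

  ar-injective : {x y : Ob} {f g : Ar x y} → (∂A x y , f) ≡ (∂A x y , g) → f ≡ g
  ar-injective e = ,-injectiveʳ-UIP uip² (cong ends e)

  -- Boundaries that agree except at p, where they are f and g, have the same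
  -- image under every morphism that identifies f and g.

  agree : {M : Str ℓ′} (h : S ⇒ M) {x y : Ob} {f g : Ar x y} → _⇒_.ar h f ≡ _⇒_.ar h g →
          {R : Sort} (p : R ⇾ A) (α β : ∂ S R) →
          α ↾ p ≡ (∂A x y , f) → β ↾ p ≡ (∂A x y , g) →
          ((q : R ⇾ A) → q ≢ p → α ↾ q ≡ β ↾ q) → ∂⟨ h ⟩ α ≡ ∂⟨ h ⟩ β
  agree h hf≡hg i (∂I f₁) (∂I f₂) refl β-at _ with cong (λ v → proj₁ (proj₁ (ends v))) β-at
  ... | refl with ar-injective β-at
  ... | refl = cong ∂I hf≡hg
  agree h hf≡hg s (∂E f₁ g₁) (∂E f₂ g₂) refl refl els with ar-injective (els t λ ())
  ... | refl = cong (λ u → ∂E u (_⇒_.ar h g₁)) hf≡hg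
  agree h hf≡hg t (∂E f₁ g₁) (∂E f₂ g₂) refl refl els with ar-injective (els s λ ())
  ... | refl = cong (λ u → ∂E (_⇒_.ar h f₁) u) hf≡hg
  agree h hf≡hg t₀ (∂C f₁ g₁ h₁) (∂C f₂ g₂ h₂) refl refl els
    with cong (λ v → proj₂ (proj₁ (ends v))) (els t₁ λ ())
  ... | refl with ar-injective (els t₁ λ ()) | ar-injective (els t₂ λ ())
  ... | refl | refl = cong (λ u → ∂C u (_⇒_.ar h g₁) (_⇒_.ar h h₁)) hf≡hg
  agree h hf≡hg t₁ (∂C f₁ g₁ h₁) (∂C f₂ g₂ h₂) refl refl els
    with cong (λ v → proj₁ (proj₁ (ends v))) (els t₀ λ ())
  ... | refl with ar-injective (els t₀ λ ()) | ar-injective (els t₂ λ ())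
  ... | refl | refl = cong (λ u → ∂C (_⇒_.ar h f₁) u (_⇒_.ar h h₁)) hf≡hg
  agree h hf≡hg t₂ (∂C f₁ g₁ h₁) (∂C f₂ g₂ h₂) refl refl els
    with cong (λ v → proj₂ (proj₁ (ends v))) (els t₀ λ ())
  ... | refl with ar-injective (els t₀ λ ()) | ar-injective (els t₁ λ ())
  ... | refl | refl = cong (λ u → ∂C (_⇒_.ar h f₁) (_⇒_.ar h g₁) u) hf≡hg

module _ {M : Str ℓ} where

  ar-extendEnv : ∀ {Γ Γ'} (e : Γ ⊑ Γ') {γ : ⟦ Γ ⟧ M} (z : ⟦ e ⟧⁺ γ)
                 {x y : Str.Ob (Vars Γ)} {f g : Str.Ar (Vars Γ) x y} →
                 _⇒_.ar (lk Γ γ) f ≡ _⇒_.ar (lk Γ γ) g →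
                 _⇒_.ar (lk Γ' (extendEnv e γ z)) (_⇒_.ar (wk* e) f) ≡
                 _⇒_.ar (lk Γ' (extendEnv e γ z)) (_⇒_.ar (wk* e) g)
  ar-extendEnv stop    z       eq = eq
  ar-extendEnv (e ▹ b) (z , _) eq = ar-extendEnv e z eq

  Ind-bottom : (Γ : Ctx) {K : Sort} → l K ≤ 1 → (x y : El (Vars Γ) K) {γ : ⟦ Γ ⟧ M} →
               Ind 1 Γ x y γ
  Ind-bottom Γ lK≤1 x y R (lR<lK , _) with ≤-trans (s≤s (1≤l R)) (≤-trans lR<lK lK≤1)
  ... | s≤s ()

  Equi-bottom : (Γ : Ctx) {K : Sort} → l K ≤ 1 → (α β : ∂ (Vars Γ) K) {γ : ⟦ Γ ⟧ M} →
                ∂⟨ lk Γ γ ⟩ α ≡ ∂⟨ lk Γ γ ⟩ β → Equi 1 Γ α β γ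
  Equi-bottom Γ lK≤1 α β eq =
    (λ x → subst (Fib M) eq x , Ind-bottom _ lK≤1 _ _ , λ _ _ → Ind-bottom _ lK≤1 _ _) ,
    (λ _ _ _ _ _ → Ind-bottom _ lK≤1 _ _) ,
    (λ y → subst (Fib M) (sym eq) y , Ind-bottom _ lK≤1 _ _)

  ≅-refl : (Γ : Ctx) {K : Sort} → l K ≤ 2 → (b : ∂ (Vars Γ) K) (γ : ⟦ Γ ⟧ M)
           (u : Fib M (∂⟨ lk Γ γ ⟩ b)) → Ind₂ (l K) Γ b b γ u u
  ≅-refl Γ (s≤s (s≤s ())) ∂O γ u
  ≅-refl Γ _ (∂I f)     γ u = Ind-bottom _ ≤-refl _ _
  ≅-refl Γ _ (∂E f g)   γ u = Ind-bottom _ ≤-refl _ _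
  ≅-refl Γ _ (∂C f g h) γ u = Ind-bottom _ ≤-refl _ _
  ≅-refl Γ _ (∂A x y)   γ u R (s≤s lR≤1 , _) _ p P z =
    Equi-bottom Γ' lR≤1 α β
      (agree (Ob-≟ Γ') (lk Γ' (extendEnv ext _ z)) (ar-extendEnv ext z refl)
             p α β α-at-p β-at-p elsewhere)
    where open Pair P

-- Saturation is defined for the sorts of level at most 2, where ≅ is
-- reflexive by ≅-refl.  The contexts appropriate to K are those with a
-- boundary b of K; saturation for K is required in all of them, so also in
-- those where b has repeated variables.

module _ (M : Str ℓ) where

  idtoiso : (Γ : Ctx) {K : Sort} (lK≤2 : l K ≤ 2) (b : ∂ (Vars Γ) K) (γ : ⟦ Γ ⟧ M)
            (u v : Fib M (∂⟨ lk Γ γ ⟩ b)) → u ≡ v → Ind₂ (l K) Γ b b γ u v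
  idtoiso Γ lK≤2 b γ u .u refl = ≅-refl Γ lK≤2 b γ u

  SaturatedAt : (K : Sort) → l K ≤ 2 → Set ℓ
  SaturatedAt K lK≤2 =
    (Γ : Ctx) (b : ∂ (Vars Γ) K) (γ : ⟦ Γ ⟧ M) (u v : Fib M (∂⟨ lk Γ γ ⟩ b)) →
    isEquiv (idtoiso Γ lK≤2 b γ u v)

  Saturated : (n : ℕ) → n ≤ 2 → Set ℓ
  Saturated n n≤2 = (K : Sort) (lK≤n : l K ≤ n) → SaturatedAt K (≤-trans lK≤n n≤2)

SatMod : PropTrunc → (n : ℕ) → n ≤ 2 → Theory → (ℓ : Level) → Set (lsuc ℓ)
SatMod tr n n≤2 𝕋 ℓ = Σ[ M ∈ Str ℓ ] IsModel tr M 𝕋 × Saturated M n n≤2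

record PreCat (ℓ : Level) : Set (lsuc ℓ) where
  field
    Obj     : Set ℓ
    Hom     : Obj → Obj → Set ℓ
    Hom-set : (x y : Obj) → isSet (Hom x y)
    idn     : (x : Obj) → Hom x x
    _⨾_     : {x y z : Obj} → Hom x y → Hom y z → Hom x z
    idˡ     : {x y : Obj} (f : Hom x y) → idn x ⨾ f ≡ f
    idʳ     : {x y : Obj} (f : Hom x y) → f ⨾ idn y ≡ f
    assoc   : {w x y z : Obj} (f : Hom w x) (g : Hom x y) (h : Hom y z) →
              (f ⨾ g) ⨾ h ≡ f ⨾ (g ⨾ h)

{-# OPTIONS --without-K #-}

-- At level 1 there are no sorts below, so ≅ is contractible and saturation says
-- that Id, Eq and Co are propositions.  Granted this, ≅ on A is a proposition,
-- so saturation says that Ar is a set on which ≅ implies equality.  The pair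
-- E(f , f) ≃ E(g , f) shows that ≅ implies Eq, and the congruence axioms show
-- that Eq implies ≅; hence Eq is equality, and the relations Id and Co are the
-- graphs of identity and composition operations.

module Submission where

open import Level using (Level)
open import Axiom.Extensionality.Propositional using (Extensionality)
open import Axiom.UniquenessOfIdentityProofs using (module Constant⇒UIP)
open import Data.Empty using (⊥-elim)
open import Data.List using (List; []; _∷_)
open import Data.List.Relation.Unary.All using (All; []; _∷_)
open import Data.List.Relation.Unary.All.Properties using (++⁺)
open import Data.Nat using (ℕ; _≤_; _<_; z≤n; s≤s)
open import Data.Nat.Properties using (≤-refl; <⇒≱; <-≤-trans; m<n⇒m<1+n)
open import Data.Product using (Σ; _×_; _,_; proj₁; proj₂; Σ-syntax; map₂)
open import Data.Sum using (inj₁; inj₂)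
open import Data.Unit.Polymorphic using (⊤; tt)
open import Function.Bundles using (mk↔ₛ′)
open import Function.Properties.Inverse.HalfAdjointEquivalence using (↔⇒≃; module _≃_)
open import Relation.Binary.Definitions using (DecidableEquality)
open import Relation.Binary.PropositionalEquality
  using (_≡_; _≢_; refl; sym; trans; cong; subst)
open import Defs

private variable
  a b ℓ ℓ′ : Level

-- Propositions, sets and equivalences.

isProp⇒isSet : {X : Set a} → isProp X → isSet X
isProp⇒isSet X-prop _ _ =
  Constant⇒UIP.≡-irrelevant (λ {x} {y} _ → X-prop x y) (λ _ _ → refl)

isProp-× : {X : Set a} {Y : Set b} → isProp X → isProp Y → isProp (X × Y)
isProp-× X-prop Y-prop (x , y) (x' , y') with X-prop x x' | Y-prop y y'
... | refl | refl = refl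

Σ-≡ : {X : Set a} {P : X → Set b} → (∀ x → isProp (P x)) →
      {x x' : X} {u : P x} {u' : P x'} → x ≡ x' → _≡_ {A = Σ X P} (x , u) (x' , u')
Σ-≡ P-prop refl = cong (_ ,_) (P-prop _ _ _)

isProp-Σ : {X : Set a} {P : X → Set b} → isProp X → (∀ x → isProp (P x)) → isProp (Σ X P)
isProp-Σ X-prop P-prop _ _ = Σ-≡ P-prop (X-prop _ _)

isEquiv-props : {X : Set a} {Y : Set b} → isProp X → isProp Y →
                (f : X → Y) → (Y → X) → isEquiv f
isEquiv-props X-prop Y-prop f g y =
  (g y , Y-prop _ _) , isProp-Σ X-prop (λ _ → isProp⇒isSet Y-prop _ _) _

-- Both `x` and `x'` lie in the fibre over `f x`, the latter because `Y` is a proposition, and that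
-- fibre is contractible.
isProp-dom : {X : Set a} {Y : Set b} {f : X → Y} → isEquiv f → isProp Y → isProp X
isProp-dom {f = f} f-equiv Y-prop x x' with f-equiv (f x)
... | _ , all≡ = cong proj₁ (trans (sym (all≡ (x , refl))) (all≡ (x' , Y-prop _ _)))

-- The homotopies are first improved to a half adjoint equivalence; its coherence law is what
-- contracts each fibre.
isEquiv-inverse : {X : Set a} {Y : Set b} (f : X → Y) (g : Y → X) →
                  (∀ y → f (g y) ≡ y) → (∀ x → g (f x) ≡ x) → isEquiv f
isEquiv-inverse {X = X} {Y} f g fg gf y =
  (g y , H.right-inverse-of y) , λ { (x , refl) → lemma (H.left-inverse-of x) _ (H.left-right x) }
  where
  module H = _≃_ (↔⇒≃ (mk↔ₛ′ f g fg gf))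
  lemma : {x x' : X} (p : x' ≡ x) (q : f x' ≡ f x) → cong f p ≡ q →
          _≡_ {A = Σ[ w ∈ X ] f w ≡ f x} (x' , q) (x , refl)
  lemma refl _ refl = refl

-- Sorts of level 1.

record Level1Props (M : Str ℓ) : Set ℓ where
  open Str M
  field
    Id-prop : ∀ {x f} → isProp (Id x f)
    Eq-prop : ∀ {x y f g} → isProp (Eq x y f g)
    Co-prop : ∀ {x y z f g h} → isProp (Co x y z f g h)

  Fib-prop : ∀ {K} → l K ≤ 1 → (α : ∂ M K) → isProp (Fib M α)
  Fib-prop (s≤s ()) ∂O
  Fib-prop (s≤s ()) (∂A x y)
  Fib-prop _ (∂I f)     = Id-prop
  Fib-prop _ (∂E f g)   = Eq-prop
  Fib-prop _ (∂C f g h) = Co-prop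

-- At level 1 every `Ind` is a product over no sorts, so all that remains of K(α) ≃ K(β) is a map in
-- each direction.
Equi-bottom-⇔ : {M : Str ℓ} (Γ : Ctx) {K : Sort} → l K ≤ 1 →
                (α β : ∂ (Vars Γ) K) {γ : ⟦ Γ ⟧ M} →
                (Fib M (∂⟨ lk Γ γ ⟩ α) → Fib M (∂⟨ lk Γ γ ⟩ β)) →
                (Fib M (∂⟨ lk Γ γ ⟩ β) → Fib M (∂⟨ lk Γ γ ⟩ α)) → Equi 1 Γ α β γ
Equi-bottom-⇔ Γ lK≤1 α β f g =
  (λ x → f x , Ind-bottom _ lK≤1 _ _ , λ _ _ → Ind-bottom _ lK≤1 _ _) ,
  (λ _ _ _ _ _ → Ind-bottom _ lK≤1 _ _) ,
  (λ y → g y , Ind-bottom _ lK≤1 _ _)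

-- The pair that detects equality of arrows.

numO-bound : (Γ : Ctx) (x : Str.Ob (Vars Γ)) → numO Γ x < len Γ
numO-bound (Γ ▹ b) (here _)  = ≤-refl
numO-bound (Γ ▹ b) (there x) = m<n⇒m<1+n (numO-bound Γ x)

numA-bound : (Γ : Ctx) {x y : Str.Ob (Vars Γ)} (f : Str.Ar (Vars Γ) x y) → numA Γ f < len Γ
numA-bound (Γ ▹ b) (here _)  = ≤-refl
numA-bound (Γ ▹ b) (there f) = m<n⇒m<1+n (numA-bound Γ f)

nums-bound : (Γ : Ctx) {K : Sort} (α : ∂ (Vars Γ) K) → All (_< len Γ) (nums Γ α)
nums-bound Γ ∂O           = []
nums-bound Γ (∂A x y)     = numO-bound Γ _ ∷ numO-bound Γ _ ∷ []
nums-bound Γ (∂I f)       = numO-bound Γ _ ∷ numA-bound Γ f ∷ []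
nums-bound Γ (∂E f g)     =
  numO-bound Γ _ ∷ numO-bound Γ _ ∷ numA-bound Γ f ∷ numA-bound Γ g ∷ []
nums-bound Γ (∂C f g h)   =
  numO-bound Γ _ ∷ numO-bound Γ _ ∷ numO-bound Γ _ ∷
  numA-bound Γ f ∷ numA-bound Γ g ∷ numA-bound Γ h ∷ []

-- Serves for the field `new` of a pair that adds no variables: every number that occurs is an old
-- one.
InOrder-old : (n : ℕ) {ks : List ℕ} → All (_< n) ks → InOrder n n ks
InOrder-old n []           = refl
InOrder-old n (k<n ∷ ks<n) = inj₁ (k<n , InOrder-old n ks<n)

el-id⇒ : {S : Str ℓ} {K : Sort} (v : El S K) → el id⇒ v ≡ v
el-id⇒ (∂O , _)       = refl
el-id⇒ (∂A _ _ , _)   = refl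
el-id⇒ (∂I _ , _)     = refl
el-id⇒ (∂E _ _ , _)   = refl
el-id⇒ (∂C _ _ _ , _) = refl

-- After `s` or `t`, the arrows `d` and `c` give the distinct composites `ds` and `cs`, so no
-- equation between the endpoints of `x` is imposed. For `I` both composites are `di`, and the
-- endpoints would have to be equal.
E∈𝓛 : (S : Str ℓ) (x : El S A) → _∈𝓛_ S E x
E∈𝓛 S x = ≤-refl , separated
  where
  open Restriction S
  separated : (q : 𝓛 E A) {K : Sort} (p₁ p₂ : 𝓛 A K) → p₁ ∘ q ≡ p₂ ∘ q → x ⇂ p₁ ≡ x ⇂ p₂
  separated _     𝟙     𝟙     _ = refl
  separated _     [ d ] [ d ] _ = refl
  separated _     [ c ] [ c ] _ = refl
  separated [ s ] [ d ] [ c ] ()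
  separated [ t ] [ d ] [ c ] ()
  separated [ s ] [ c ] [ d ] ()
  separated [ t ] [ c ] [ d ] ()

module _ (Γ : Ctx) {x y : Str.Ob (Vars Γ)} (f g : Str.Ar (Vars Γ) x y) where
  open Restriction (Vars Γ)

  -- Only variables in dep(f) and dep(g) occur in the two boundaries, so Γ_{α,β} is empty and `ext`
  -- is `stop`.
  Eq-pair : Pair Γ s (∂A x y , f) (∂A x y , g)
  Eq-pair = record
    { Γ' = Γ ; ext = stop ; α = ∂E f f ; β = ∂E g f
    ; α-at-p = refl ; β-at-p = refl
    ; elsewhere = λ { s s≢s → ⊥-elim (s≢s refl) ; t _ → refl }
    ; old = λ v → λ
        { (inj₁ (s  , e)) → inj₁ (𝟙     , trans e (el-id⇒ v))
        ; (inj₁ (t  , e)) → inj₁ (𝟙     , trans e (el-id⇒ v))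
        ; (inj₁ (ds , e)) → inj₁ ([ d ] , trans e (el-id⇒ v))
        ; (inj₁ (cs , e)) → inj₁ ([ c ] , trans e (el-id⇒ v))
        ; (inj₂ (s  , e)) → inj₂ (𝟙     , trans e (el-id⇒ v))
        ; (inj₂ (t  , e)) → inj₁ (𝟙     , trans e (el-id⇒ v))
        ; (inj₂ (ds , e)) → inj₁ ([ d ] , trans e (el-id⇒ v))
        ; (inj₂ (cs , e)) → inj₁ ([ c ] , trans e (el-id⇒ v)) }
    ; new = InOrder-old (len Γ) (++⁺ (nums-bound Γ (∂E f f)) (nums-bound Γ (∂E g f))) }

  Ind⇒Eq : {M : Str ℓ} {γ : ⟦ Γ ⟧ M} → let module h = _⇒_ (lk {M = M} Γ γ) in
           Str.Eq M _ _ (h.ar f) (h.ar f) →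
           Ind 2 Γ (∂A x y , f) (∂A x y , g) γ → Str.Eq M _ _ (h.ar g) (h.ar f)
  Ind⇒Eq f≈f ind =
    -- The forward map of E(f , f) ≃ E(g , f), applied to reflexivity at `f`.
    proj₁ (proj₁ (ind E (E∈𝓛 (Vars Γ) _) (E∈𝓛 (Vars Γ) _) s Eq-pair tt) f≈f)

-- Congruence and indistinguishability of arrows.

-- The congruence axioms of `𝕋cat` freed of truncation, which is possible once the level 1 sorts are
-- propositions.
record Congruence (M : Str ℓ) : Set ℓ where
  open Str M
  field
    Eq-refl  : ∀ {x y} (f : Ar x y) → Eq x y f f
    Eq-sym   : ∀ {x y} {f g : Ar x y} → Eq x y f g → Eq x y g f
    Eq-trans : ∀ {x y} {f g h : Ar x y} → Eq x y f g → Eq x y g h → Eq x y f h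
    Id-cong  : ∀ {x} {f g : Ar x x} → Eq x x f g → Id x f → Id x g
    Co-cong  : ∀ {x y z} {f f' : Ar x y} {g g' : Ar y z} {h h' : Ar x z} →
               Eq x y f f' → Eq y z g g' → Eq x z h h' →
               Co x y z f g h → Co x y z f' g' h'

private
  source target : {S : Str ℓ} → El S A → Str.Ob S
  source (∂A x _ , _) = x
  target (∂A _ y , _) = y

module _ {M : Str ℓ} (congruence : Congruence M) where
  open Congruence congruence
  open Restriction

  -- Objects of `S` have decidable equality, so agreement away from `p` forces the other entries of
  -- `α` and `β` to coincide. The congruence law then acts in the slot `p`, with reflexivity in the
  -- others; for `E` symmetry and transitivity play this role.
  Fib-cong : {S : Str ℓ′} → DecidableEquality (Str.Ob S) → (h : S ⇒ M) →
             {x y : Str.Ob S} {f g : Str.Ar S x y} →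
             Str.Eq M _ _ (_⇒_.ar h f) (_⇒_.ar h g) →
             {R : Sort} (p : R ⇾ A) (α β : ∂ S R) →
             _↾_ S α p ≡ (∂A x y , f) → _↾_ S β p ≡ (∂A x y , g) →
             ((q : R ⇾ A) → q ≢ p → _↾_ S α q ≡ _↾_ S β q) →
             Fib M (∂⟨ h ⟩ α) → Fib M (∂⟨ h ⟩ β)
  -- Over a loop the same object occurs twice in `β-at`, so matching it with `refl` would need K;
  -- decidable equality of objects takes its place.
  Fib-cong _≟_ h f≈g i (∂I _) (∂I _) refl β-at _ with cong source β-at
  ... | refl with ar-injective _≟_ β-at
  ... | refl = Id-cong f≈g
  Fib-cong _≟_ h f≈g s (∂E _ _) (∂E _ _) refl refl els with ar-injective _≟_ (els t λ ())
  ... | refl = Eq-trans (Eq-sym f≈g)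
  Fib-cong _≟_ h f≈g t (∂E _ _) (∂E _ _) refl refl els with ar-injective _≟_ (els s λ ())
  ... | refl = λ u → Eq-trans u f≈g
  Fib-cong _≟_ h f≈g t₀ (∂C _ _ _) (∂C _ _ _) refl refl els with cong target (els t₁ λ ())
  ... | refl with ar-injective _≟_ (els t₁ λ ()) | ar-injective _≟_ (els t₂ λ ())
  ... | refl | refl = Co-cong f≈g (Eq-refl _) (Eq-refl _)
  Fib-cong _≟_ h f≈g t₁ (∂C _ _ _) (∂C _ _ _) refl refl els with cong source (els t₀ λ ())
  ... | refl with ar-injective _≟_ (els t₀ λ ()) | ar-injective _≟_ (els t₂ λ ())
  ... | refl | refl = Co-cong (Eq-refl _) f≈g (Eq-refl _)
  Fib-cong _≟_ h f≈g t₂ (∂C _ _ _) (∂C _ _ _) refl refl els with cong target (els t₀ λ ())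
  ... | refl with ar-injective _≟_ (els t₀ λ ()) | ar-injective _≟_ (els t₁ λ ())
  ... | refl | refl = Co-cong (Eq-refl _) (Eq-refl _) f≈g

  Eq-extendEnv : ∀ {Γ Γ'} (e : Γ ⊑ Γ') {γ : ⟦ Γ ⟧ M} (z : ⟦ e ⟧⁺ γ)
                 {x y : Str.Ob (Vars Γ)} {f g : Str.Ar (Vars Γ) x y} →
                 Str.Eq M _ _ (_⇒_.ar (lk Γ γ) f) (_⇒_.ar (lk Γ γ) g) →
                 Str.Eq M _ _ (_⇒_.ar (lk Γ' (extendEnv e γ z)) (_⇒_.ar (wk* e) f))
                              (_⇒_.ar (lk Γ' (extendEnv e γ z)) (_⇒_.ar (wk* e) g))
  Eq-extendEnv stop    z       f≈g = f≈g
  Eq-extendEnv (e ▹ b) (z , _) f≈g = Eq-extendEnv e z f≈g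

  -- Every sort below `A` has level 1, so each factor amounts to two maps; the map back is
  -- `Fib-cong` for the symmetric equality.
  Eq⇒Ind : (Γ : Ctx) {γ : ⟦ Γ ⟧ M} {x y : Str.Ob (Vars Γ)} (f g : Str.Ar (Vars Γ) x y) →
           Str.Eq M _ _ (_⇒_.ar (lk Γ γ) f) (_⇒_.ar (lk Γ γ) g) →
           Ind 2 Γ (∂A x y , f) (∂A x y , g) γ
  Eq⇒Ind Γ f g f≈g R (s≤s lR≤1 , _) _ p P z =
    Equi-bottom-⇔ Γ' lR≤1 α β
      (Fib-cong (Ob-≟ Γ') h (Eq-extendEnv ext z f≈g) p α β α-at-p β-at-p elsewhere)
      (Fib-cong (Ob-≟ Γ') h (Eq-extendEnv ext z (Eq-sym f≈g)) p β α β-at-p α-at-p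
                (λ q q≢p → sym (elsewhere q q≢p)))
    where
    open Pair P
    h = lk Γ' (extendEnv ext _ z)

-- Functional structures and precategories.

-- A structure in which Eq is equality and Id and Co are the graphs of
-- operations that make it a precategory.
record Functional (M : Str ℓ) : Set ℓ where
  open Str M
  field
    level1-props : Level1Props M
    Ar-set       : ∀ {x y} → isSet (Ar x y)
    Eq-refl      : ∀ {x y} (f : Ar x y) → Eq x y f f
    Eq⇒≡         : ∀ {x y} {f g : Ar x y} → Eq x y f g → f ≡ g
    composite    : ∀ {x y z} (f : Ar x y) (g : Ar y z) → Σ[ h ∈ Ar x z ] Co x y z f g h
    Co-unique    : ∀ {x y z} {f : Ar x y} {g : Ar y z} {h h' : Ar x z} →
                   Co x y z f g h → Co x y z f g h' → h ≡ h'
    identity     : ∀ x → Σ[ j ∈ Ar x x ] Id x j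
    Id-unitˡ     : ∀ {x y} {j : Ar x x} {f : Ar x y} → Id x j → Co x x y j f f
    Id-unitʳ     : ∀ {x y} {j : Ar y y} {f : Ar x y} → Id y j → Co x y y f j f
    Co-assoc     : ∀ {w x y z} {f : Ar w x} {g : Ar x y} {h : Ar y z}
                   {p : Ar w y} {q : Ar x z} {k : Ar w z} →
                   Co w x y f g p → Co x y z g h q → Co w y z p h k → Co w x z f q k

  open Level1Props level1-props public

  -- Both `j` and `j'` are composites of `j` followed by `j'`, since `j'` is a right unit and `j` a
  -- left unit.
  Id-unique : ∀ {x} {j j' : Ar x x} → Id x j → Id x j' → j ≡ j'
  Id-unique u u' = Co-unique (Id-unitʳ u') (Id-unitˡ u)

toPreCat : {M : Str ℓ} → Functional M → PreCat ℓ
toPreCat {M = M} F = record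
  { Obj = Ob ; Hom = Ar ; Hom-set = λ _ _ → Ar-set
  ; idn = λ x → proj₁ (identity x)
  ; _⨾_ = λ f g → proj₁ (composite f g)
  ; idˡ = λ f → Co-unique (proj₂ (composite _ f)) (Id-unitˡ (proj₂ (identity _)))
  ; idʳ = λ f → Co-unique (proj₂ (composite f _)) (Id-unitʳ (proj₂ (identity _)))
  ; assoc = λ f g h →
      sym (Co-unique (proj₂ (composite f _))
        (Co-assoc (proj₂ (composite f g)) (proj₂ (composite g h)) (proj₂ (composite _ h)))) }
  where
  open Str M
  open Functional F

toStr : PreCat ℓ → Str ℓ
toStr P = record
  { Ob = Obj ; Ar = Hom
  ; Id = λ x f → idn x ≡ f
  ; Eq = λ x y f g → f ≡ g
  ; Co = λ x y z f g h → f ⨾ g ≡ h }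
  where open PreCat P

toStr-functional : (P : PreCat ℓ) → Functional (toStr P)
toStr-functional P = record
  { level1-props = record
      { Id-prop = Hom-set _ _ _ _ ; Eq-prop = Hom-set _ _ _ _ ; Co-prop = Hom-set _ _ _ _ }
  ; Ar-set    = Hom-set _ _
  ; Eq-refl   = λ _ → refl
  ; Eq⇒≡      = λ e → e
  ; composite = λ f g → f ⨾ g , refl
  ; Co-unique = λ { refl refl → refl }
  ; identity  = λ x → idn x , refl
  ; Id-unitˡ  = λ { refl → idˡ _ }
  ; Id-unitʳ  = λ { refl → idʳ _ }
  ; Co-assoc  = λ { refl refl refl → sym (assoc _ _ _) } }
  where open PreCat P

-- Saturation at level 1.

-- Each context is the generic one for its boundary, so its interpretations reach every fibre of the
-- relation.
saturated⇒level1-props : {M : Str ℓ} → Saturated M 2 ≤-refl → Level1Props M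
saturated⇒level1-props {M = M} sat = record
  { Id-prop = λ {x} {f} u v →
      proj₁ (proj₁ (sat I (s≤s z≤n) (∅ ▹ ∂O ▹ ∂A v0 v0) (∂I v0) ((tt , x) , f) u v
        (Ind-bottom _ ≤-refl _ _)))
  ; Eq-prop = λ {x} {y} {f} {g} u v →
      proj₁ (proj₁ (sat E (s≤s z≤n) (∅ ▹ ∂O ▹ ∂O ▹ ∂A v1 v0 ▹ ∂A v2 v1) (∂E v1 v0)
        ((((tt , x) , y) , f) , g) u v (Ind-bottom _ ≤-refl _ _)))
  ; Co-prop = λ {x} {y} {z} {f} {g} {h} u v →
      proj₁ (proj₁ (sat C (s≤s z≤n)
        (∅ ▹ ∂O ▹ ∂O ▹ ∂O ▹ ∂A v2 v1 ▹ ∂A v2 v1 ▹ ∂A v4 v2) (∂C v2 v1 v0)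
        ((((((tt , x) , y) , z) , f) , g) , h) u v (Ind-bottom _ ≤-refl _ _))) }

-- Functional structures are models.

module Truncated (tr : PropTrunc) where
  open PropTrunc tr

  -- The truncated type is the shape in which `f ≈ g`, `isId f` and `isComp f g h` are interpreted.
  untruncate : {X : Set ℓ} → isProp X → ∥ Σ X (λ _ → ⊤ {ℓ′}) ∥ → X
  untruncate X-prop = ∥∥-rec X-prop proj₁

  truncate : {X : Set ℓ} → X → ∥ Σ X (λ _ → ⊤ {ℓ′}) ∥
  truncate u = ∣ u , tt ∣

  functional⇒model : {M : Str ℓ} → Functional M → IsModel tr M 𝕋cat
  functional⇒model {M = M} F =
      (λ x y f → eq refl)
    ∷ (λ x y f g e → eq (sym (uneq e)))
    ∷ (λ x y f g h (e , e') → eq (trans (uneq e) (uneq e')))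
    ∷ (λ x f g (e , u) → subst (λ k → ∥ Σ (Id x k) _ ∥) (uneq e) u)
    ∷ (λ x y z f f' g g' h h' (e , e' , e″ , u) →
        substCo (uneq e) (uneq e') (uneq e″) u)
    ∷ (λ x y z f g → ∣ map₂ truncate (composite f g) ∣)
    ∷ (λ x y z f g h h' (u , u') → eq (Co-unique (unco u) (unco u')))
    ∷ (λ x → ∣ map₂ truncate (identity x) ∣)
    ∷ (λ x y j f u → truncate (Id-unitˡ (untruncate Id-prop u)))
    ∷ (λ x y j f u → truncate (Id-unitʳ (untruncate Id-prop u)))
    ∷ (λ w x y z f g h p q k (u , u' , u″) →
        truncate (Co-assoc (unco u) (unco u') (unco u″)))
    ∷ []
    where
    open Str M
    open Functional F
    eq : ∀ {x y} {f g : Ar x y} → f ≡ g → ∥ Σ (Eq x y f g) (λ _ → ⊤) ∥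
    eq refl = truncate (Eq-refl _)
    uneq : ∀ {x y} {f g : Ar x y} → ∥ Σ (Eq x y f g) (λ _ → ⊤) ∥ → f ≡ g
    uneq e = Eq⇒≡ (untruncate Eq-prop e)
    unco : ∀ {x y z} {f : Ar x y} {g : Ar y z} {h : Ar x z} →
           ∥ Σ (Co x y z f g h) (λ _ → ⊤) ∥ → Co x y z f g h
    unco = untruncate Co-prop
    substCo : ∀ {x y z} {f f' : Ar x y} {g g' : Ar y z} {h h' : Ar x z} →
              f ≡ f' → g ≡ g' → h ≡ h' →
              ∥ Σ (Co x y z f g h) (λ _ → ⊤) ∥ → ∥ Σ (Co x y z f' g' h') (λ _ → ⊤) ∥
    substCo refl refl refl u = u

-- Extensionality from univalence.

module FromUnivalence (ua : ∀ ℓ → Univalence ℓ) where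

  propext : {P Q : Set ℓ} → isProp P → isProp Q → (P → Q) → (Q → P) → P ≡ Q
  propext P-prop Q-prop f g =
    proj₁ (proj₁ (ua _ _ _ (f , isEquiv-props P-prop Q-prop f g)))

  -- By univalence `e` comes from a path, and path induction turns it into the identity.
  precomp-injective : {X Y : Set a} {Z : Set b} (e : X ≃ Y) {f g : Y → Z} →
                      (λ x → f (proj₁ e x)) ≡ (λ x → g (proj₁ e x)) → f ≡ g
  precomp-injective e with proj₁ (ua _ _ _ e)
  ... | refl , refl = λ f≡g → f≡g

  -- The two projections from the path space of Y agree after composition with
  -- the diagonal, which is an equivalence.
  funext-nondep : {X : Set a} {Y : Set b} {f g : X → Y} → (∀ x → f x ≡ g x) → f ≡ g
  funext-nondep {Y = Y} {f} {g} f~g =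
    cong (λ π x → π (f x , g x , f~g x))
         (precomp-injective (diagonal , λ w → centre w , central w)
                            {λ w → proj₁ w} {λ w → proj₁ (proj₂ w)} refl)
    where
    Paths = Σ[ y ∈ Y ] Σ[ y' ∈ Y ] y ≡ y'
    diagonal : Y → Paths
    diagonal y = y , y , refl
    centre : ∀ w → Σ[ y ∈ Y ] diagonal y ≡ w
    centre (y , _ , refl) = y , refl
    central : ∀ w (v : Σ[ y ∈ Y ] diagonal y ≡ w) → centre w ≡ v
    central _ (_ , refl) = refl

  -- Nondependent extensionality and `propext` make `B` the constant family `⊤`, whose sections
  -- agree by the η-rule.
  isProp-Π-contr : {X : Set a} {B : X → Set b} → (∀ x → isContr (B x)) → isProp (∀ x → B x)
  isProp-Π-contr {X = X} B-contr =
    subst (λ B → isProp ((x : X) → B x)) (sym B≡⊤) (λ _ _ → refl)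
    where
    B≡⊤ = funext-nondep λ x →
      propext (λ y y' → trans (sym (proj₂ (B-contr x) y)) (proj₂ (B-contr x) y'))
              (λ _ _ → refl) (λ _ → tt) (λ _ → proj₁ (B-contr x))

  -- Both functions are first components of sections of the family of singletons based at `f x`,
  -- which is pointwise contractible.
  funext : Extensionality a b
  funext {f = f} {g} f~g =
    cong (λ k x → proj₁ (k x))
         (isProp-Π-contr {B = λ x → Σ[ y ∈ _ ] f x ≡ y}
                         (λ x → (f x , refl) , λ { (_ , refl) → refl })
                         (λ x → f x , refl) (λ x → g x , f~g x))

  isProp-Π : {X : Set a} {B : X → Set b} → (∀ x → isProp (B x)) → isProp (∀ x → B x)
  isProp-Π B-prop f g = funext λ x → B-prop x (f x) (g x)

  isProp-isContr : {X : Set a} → isProp (isContr X)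
  isProp-isContr (x₀ , x₀≡) =
    isProp-Σ X-prop (λ _ → isProp-Π λ _ → isProp⇒isSet X-prop _ _) (x₀ , x₀≡)
    where X-prop = λ x y → trans (sym (x₀≡ x)) (x₀≡ y)

  isProp-isEquiv : {X : Set a} {Y : Set b} (f : X → Y) → isProp (isEquiv f)
  isProp-isEquiv f = isProp-Π λ _ → isProp-isContr

  isProp-isSet : {X : Set a} → isProp (isSet X)
  isProp-isSet X-set =
    (isProp-Π λ x → isProp-Π λ y → isProp-Π λ p → isProp-Π λ q →
      isProp⇒isSet (X-set x y) p q) X-set

  -- Propositionality of models, saturation and indistinguishability.

  module _ (tr : PropTrunc) (M : Str ℓ) where
    open PropTrunc tr

    isProp-⟦⟧ᶠ : ∀ {Γ} (φ : Formula Γ) (γ : ⟦ Γ ⟧ M) → isProp (⟦_⟧ᶠ tr M φ γ)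
    isProp-⟦⟧ᶠ ⊤'       γ = λ _ _ → refl
    isProp-⟦⟧ᶠ ⊥'       γ = λ ()
    isProp-⟦⟧ᶠ (φ ∧' ψ) γ = isProp-× (isProp-⟦⟧ᶠ φ γ) (isProp-⟦⟧ᶠ ψ γ)
    isProp-⟦⟧ᶠ (φ ∨' ψ) γ = ∥∥-prop
    isProp-⟦⟧ᶠ (φ ⇒' ψ) γ = isProp-Π λ _ → isProp-⟦⟧ᶠ ψ γ
    isProp-⟦⟧ᶠ (∀' _ φ) γ = isProp-Π λ u → isProp-⟦⟧ᶠ φ (γ , u)
    isProp-⟦⟧ᶠ (∃' _ φ) γ = ∥∥-prop

    isProp-IsModel : (𝕋 : Theory) → isProp (IsModel tr M 𝕋)
    isProp-IsModel []      []       []       = refl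
    isProp-IsModel (φ ∷ 𝕋) (p ∷ ps) (q ∷ qs)
      with isProp-⟦⟧ᶠ φ tt p q | isProp-IsModel 𝕋 ps qs
    ... | refl | refl = refl

  isProp-Saturated : (M : Str ℓ) (n : ℕ) (n≤2 : n ≤ 2) → isProp (Saturated M n n≤2)
  isProp-Saturated M n n≤2 =
    isProp-Π λ K → isProp-Π λ _ → isProp-Π λ Γ → isProp-Π λ b → isProp-Π λ γ →
    isProp-Π λ u → isProp-Π λ v → isProp-isEquiv _

  SatMod-≡ : (tr : PropTrunc) {n : ℕ} {n≤2 : n ≤ 2} {𝕋 : Theory} {X Y : SatMod tr n n≤2 𝕋 ℓ} →
             proj₁ X ≡ proj₁ Y → X ≡ Y
  SatMod-≡ tr {𝕋 = 𝕋} =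
    Σ-≡ λ M → isProp-× (isProp-IsModel tr M 𝕋) (isProp-Saturated M _ _)

  module _ {M : Str ℓ} where

    isProp-Ind-bottom : (Γ : Ctx) {K : Sort} → l K ≤ 1 → (x y : El (Vars Γ) K) {γ : ⟦ Γ ⟧ M} →
                        isProp (Ind 1 Γ x y γ)
    isProp-Ind-bottom Γ lK≤1 x y _ _ = funext λ R → funext λ (lR<lK , _) →
      ⊥-elim (<⇒≱ (<-≤-trans lR<lK lK≤1) (1≤l R))

    module _ (props : Level1Props M) where
      open Level1Props props

      -- Only the untruncated choices of `y` and `x` could carry data, and `Fib-prop` makes them
      -- unique.
      isProp-Equi-bottom : (Γ : Ctx) {K : Sort} → l K ≤ 1 → (α β : ∂ (Vars Γ) K) {γ : ⟦ Γ ⟧ M} →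
                           isProp (Equi 1 Γ α β γ)
      isProp-Equi-bottom Γ lK≤1 α β {γ} =
        isProp-×
          (isProp-Π λ _ → isProp-Σ (Fib-prop lK≤1 (∂⟨ lk Γ γ ⟩ β)) λ _ →
            isProp-× (isProp-Ind-bottom _ lK≤1 _ _)
                     (isProp-Π λ _ → isProp-Π λ _ → isProp-Ind-bottom _ lK≤1 _ _))
          (isProp-×
            (isProp-Π λ _ → isProp-Π λ _ → isProp-Π λ _ → isProp-Π λ _ → isProp-Π λ _ →
              isProp-Ind-bottom _ lK≤1 _ _)
            (isProp-Π λ _ → isProp-Σ (Fib-prop lK≤1 (∂⟨ lk Γ γ ⟩ α)) λ _ →
              isProp-Ind-bottom _ lK≤1 _ _))

      isProp-Ind-A : (Γ : Ctx) (x y : El (Vars Γ) A) {γ : ⟦ Γ ⟧ M} → isProp (Ind 2 Γ x y γ)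
      isProp-Ind-A Γ x y =
        isProp-Π λ R → isProp-Π λ { (s≤s lR≤1 , _) → isProp-Π λ _ → isProp-Π λ p →
        isProp-Π λ P → isProp-Π λ z → isProp-Equi-bottom _ lR≤1 _ _ }

  -- The two round trips.

  -- Objects and arrows return unchanged. Each of the three relations is a proposition equivalent to
  -- its graph: existence gives one implication, uniqueness the other.
  toStr-toPreCat : {M : Str ℓ} (F : Functional M) → toStr (toPreCat F) ≡ M
  toStr-toPreCat {M = M} F =
    Str-≡ (funext λ x → funext λ f → propext (Ar-set _ _) Id-prop
             (λ { refl → proj₂ (identity x) }) (Id-unique (proj₂ (identity x))))
          (funext λ x → funext λ y → funext λ f → funext λ g → propext (Ar-set _ _) Eq-prop
             (λ { refl → Eq-refl f }) Eq⇒≡)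
          (funext λ x → funext λ y → funext λ z → funext λ f → funext λ g → funext λ h →
             propext (Ar-set _ _) Co-prop
               (λ { refl → proj₂ (composite f g) }) (Co-unique (proj₂ (composite f g))))
    where
    open Str M
    open Functional F
    Str-≡ : ∀ {Id' Eq' Co'} → Id' ≡ Id → Eq' ≡ Eq → Co' ≡ Co →
            record { Ob = Ob ; Ar = Ar ; Id = Id' ; Eq = Eq' ; Co = Co' } ≡ M
    Str-≡ refl refl refl = refl

  module _ {Obj : Set ℓ} {Hom : Obj → Obj → Set ℓ} where

    -- All arguments are explicit, so that funext applies to the operations.
    Laws : (∀ x → Hom x x) → (∀ x y z → Hom x y → Hom y z → Hom x z) → Set ℓ
    Laws idn comp =
      (∀ x y → isSet (Hom x y)) ×
      (∀ x y (f : Hom x y) → comp _ _ _ (idn x) f ≡ f) ×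
      (∀ x y (f : Hom x y) → comp _ _ _ f (idn y) ≡ f) ×
      (∀ w x y z (f : Hom w x) (g : Hom x y) (h : Hom y z) →
        comp _ _ _ (comp _ _ _ f g) h ≡ comp _ _ _ f (comp _ _ _ g h))

    isProp-Laws : ∀ idn comp → isProp (Laws idn comp)
    isProp-Laws idn comp laws@(Hom-set , _) =
      isProp-×
        (isProp-Π λ _ → isProp-Π λ _ → isProp-isSet)
        (isProp-× (isProp-Π λ _ → isProp-Π λ _ → isProp-Π λ _ → Hom-set _ _ _ _)
        (isProp-× (isProp-Π λ _ → isProp-Π λ _ → isProp-Π λ _ → Hom-set _ _ _ _)
        (isProp-Π λ _ → isProp-Π λ _ → isProp-Π λ _ → isProp-Π λ _ → isProp-Π λ _ →
          isProp-Π λ _ → isProp-Π λ _ → Hom-set _ _ _ _)))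
        laws

    mkPreCat : ∀ idn comp → Laws idn comp → PreCat ℓ
    mkPreCat idn comp (Hom-set , idˡ , idʳ , assoc) = record
      { Obj = Obj ; Hom = Hom ; Hom-set = Hom-set
      ; idn = idn ; _⨾_ = comp _ _ _
      ; idˡ = idˡ _ _ ; idʳ = idʳ _ _ ; assoc = assoc _ _ _ _ }

    mkPreCat-≡ : ∀ {idn idn' comp comp'} → idn ≡ idn' → comp ≡ comp' →
                 (laws : Laws idn comp) (laws' : Laws idn' comp') →
                 mkPreCat idn comp laws ≡ mkPreCat idn' comp' laws'
    mkPreCat-≡ {idn} {comp = comp} refl refl laws laws' =
      cong (mkPreCat idn comp) (isProp-Laws idn comp laws laws')

  -- The choice of `F` does not matter: in `toStr P`, the witness attached to an identity or
  -- composite chosen by `F` is itself an equation with that of `P`.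
  toPreCat-toStr : (P : PreCat ℓ) (F : Functional (toStr P)) → toPreCat F ≡ P
  toPreCat-toStr P F =
    mkPreCat-≡
      (funext λ x → sym (proj₂ (identity x)))
      (funext λ x → funext λ y → funext λ z → funext λ f → funext λ g →
        sym (proj₂ (composite f g)))
      (Q.Hom-set , (λ _ _ → Q.idˡ) , (λ _ _ → Q.idʳ) , (λ _ _ _ _ → Q.assoc))
      (P.Hom-set , (λ _ _ → P.idˡ) , (λ _ _ → P.idʳ) , (λ _ _ _ _ → P.assoc))
    where
    open Functional F
    module P = PreCat P
    module Q = PreCat (toPreCat F)

  -- Saturation on arrows.

  -- Over a variable Γ, Ind does not unfold far; over the closed contexts at which
  -- these lemmas are applied, comparing its instances is infeasible.
  module _ {M : Str ℓ} (sat : Saturated M 2 ≤-refl)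
           (Γ : Ctx) (x y : Str.Ob (Vars Γ)) {γ : ⟦ Γ ⟧ M} where

    saturated⇒Ar-set-at : isSet (Fib M (∂⟨ lk Γ γ ⟩ (∂A x y)))
    saturated⇒Ar-set-at f g =
      isProp-dom (sat A ≤-refl Γ (∂A x y) γ f g)
                 (isProp-Ind-A (saturated⇒level1-props sat) _ _ _)

    saturated⇒Eq⇒≡-at : Congruence M → {f g : Fib M (∂⟨ lk Γ γ ⟩ (∂A x y))} →
                        Str.Eq M _ _ f g → f ≡ g
    saturated⇒Eq⇒≡-at congruence {f} {g} f≈g =
      proj₁ (proj₁ (sat A ≤-refl Γ (∂A x y) γ f g
        -- `Ind₂` compares two fresh variables, here `v1` and `v0`, which are interpreted as `f` and
        -- `g`.
        (Eq⇒Ind congruence (Γ ▹ ∂A x y ▹ ∂A (there x) (there y)) v1 v0 f≈g)))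

  saturated⇒Ar-set : {M : Str ℓ} → Saturated M 2 ≤-refl →
                     ∀ {x y} → isSet (Str.Ar M x y)
  saturated⇒Ar-set sat {x} {y} =
    saturated⇒Ar-set-at sat (∅ ▹ ∂O ▹ ∂O) v1 v0 {(tt , x) , y}

  saturated⇒Eq⇒≡ : {M : Str ℓ} → Congruence M → Saturated M 2 ≤-refl →
                   ∀ {x y} {f g : Str.Ar M x y} → Str.Eq M x y f g → f ≡ g
  saturated⇒Eq⇒≡ congruence sat {x} {y} =
    saturated⇒Eq⇒≡-at sat (∅ ▹ ∂O ▹ ∂O) v1 v0 {(tt , x) , y} congruence

  functional⇒saturated : {M : Str ℓ} → Functional M → Saturated M 2 ≤-refl
  functional⇒saturated {M = M} F = λ
    { O (s≤s (s≤s ()))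
    ; A _ Γ (∂A x y) γ u v →
        isEquiv-props (Ar-set _ _) (isProp-Ind-A level1-props _ _ _) _
          -- Between propositions a map back suffices; `Ind⇒Eq` yields `Eq` from `v` to `u`, hence
          -- the `sym`.
          λ ind → sym (Eq⇒≡ (Ind⇒Eq _ _ _ (Eq-refl u) ind))
    ; I _ Γ b γ u v → bottom ≤-refl Γ b u v
    ; E _ Γ b γ u v → bottom ≤-refl Γ b u v
    ; C _ Γ b γ u v → bottom ≤-refl Γ b u v }
    where
    open Functional F
    bottom : {K : Sort} → l K ≤ 1 → (Γ : Ctx) (b : ∂ (Vars Γ) K) {γ : ⟦ Γ ⟧ M}
             (u v : Fib M (∂⟨ lk Γ γ ⟩ b)) {f : u ≡ v → Ind₂ 1 Γ b b γ u v} → isEquiv f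
    bottom lK≤1 Γ b {γ} u v =
      isEquiv-props (isProp⇒isSet fib-prop _ _) (isProp-Ind-bottom _ lK≤1 _ _) _
                    (λ _ → fib-prop _ _)
      where fib-prop = Fib-prop lK≤1 (∂⟨ lk Γ γ ⟩ b)

  -- Saturated models are precategories.

  module _ (tr : PropTrunc) where
    open PropTrunc tr
    open Truncated tr

    model⇒functional : {M : Str ℓ} → IsModel tr M 𝕋cat → Saturated M 2 ≤-refl → Functional M
    model⇒functional {M = M}
      (Eq-reflᵗ ∷ Eq-symᵗ ∷ Eq-transᵗ ∷ Id-congᵗ ∷ Co-congᵗ ∷ compositeᵗ ∷ Co-uniqueᵗ ∷
       identityᵗ ∷ Id-unitˡᵗ ∷ Id-unitʳᵗ ∷ Co-assocᵗ ∷ []) sat = record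
      { level1-props = props
      ; Ar-set = saturated⇒Ar-set sat
      ; Eq-refl = Congruence.Eq-refl congruence
      ; Eq⇒≡ = Eq⇒≡
      ; composite = λ {x} {y} {z} f g →
          -- A composite can leave the truncation because it is unique and `Co` is a proposition.
          ∥∥-rec (λ (h , u) (h' , u') → Σ-≡ (λ _ → Co-prop) (Co-unique u u'))
                 (map₂ (untruncate Co-prop)) (compositeᵗ x y z f g)
      ; Co-unique = Co-unique
      ; identity = λ x →
          -- Likewise for identities: two of them are both composites of the first followed by the
          -- second.
          ∥∥-rec (λ (j , u) (j' , u') →
                    Σ-≡ (λ _ → Id-prop) (Co-unique (Id-unitʳ u') (Id-unitˡ u)))
                 (map₂ (untruncate Id-prop)) (identityᵗ x)
      ; Id-unitˡ = Id-unitˡ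
      ; Id-unitʳ = Id-unitʳ
      ; Co-assoc = λ {w} {x} {y} {z} {f} {g} {h} {p} {q} {k} u u' u″ → untruncate Co-prop
          (Co-assocᵗ w x y z f g h p q k (truncate u , truncate u' , truncate u″)) }
      where
      open Str M
      props : Level1Props M
      props = saturated⇒level1-props sat
      open Level1Props props

      congruence : Congruence M
      congruence = record
        { Eq-refl  = λ {x} {y} f → untruncate Eq-prop (Eq-reflᵗ x y f)
        ; Eq-sym   = λ {x} {y} {f} {g} e →
            untruncate Eq-prop (Eq-symᵗ x y f g (truncate e))
        ; Eq-trans = λ {x} {y} {f} {g} {h} e e' →
            untruncate Eq-prop (Eq-transᵗ x y f g h (truncate e , truncate e'))
        ; Id-cong  = λ {x} {f} {g} e u →
            untruncate Id-prop (Id-congᵗ x f g (truncate e , truncate u))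
        ; Co-cong  = λ {x} {y} {z} {f} {f'} {g} {g'} {h} {h'} e e' e″ u → untruncate Co-prop
            (Co-congᵗ x y z f f' g g' h h'
              (truncate e , truncate e' , truncate e″ , truncate u)) }

      Eq⇒≡ : ∀ {x y} {f g : Ar x y} → Eq x y f g → f ≡ g
      Eq⇒≡ = saturated⇒Eq⇒≡ congruence sat

      Co-unique : ∀ {x y z} {f : Ar x y} {g : Ar y z} {h h' : Ar x z} →
                  Co x y z f g h → Co x y z f g h' → h ≡ h'
      Co-unique {x} {y} {z} {f} {g} {h} {h'} u u' =
        Eq⇒≡ (untruncate Eq-prop (Co-uniqueᵗ x y z f g h h' (truncate u , truncate u')))

      Id-unitˡ : ∀ {x y} {j : Ar x x} {f : Ar x y} → Id x j → Co x x y j f f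
      Id-unitˡ {x} {y} {j} {f} u =
        untruncate Co-prop (Id-unitˡᵗ x y j f (truncate u))

      Id-unitʳ : ∀ {x y} {j : Ar y y} {f : Ar x y} → Id y j → Co x y y f j f
      Id-unitʳ {x} {y} {j} {f} u =
        untruncate Co-prop (Id-unitʳᵗ x y j f (truncate u))

    -- Kept abstract so that these large proofs are never unfolded by conversion checking.
    abstract
      SatMod⇒functional : (X : SatMod tr 2 ≤-refl 𝕋cat ℓ) → Functional (proj₁ X)
      SatMod⇒functional (_ , model , sat) = model⇒functional model sat

      toStr-isSatMod : (P : PreCat ℓ) →
                       IsModel tr (toStr P) 𝕋cat × Saturated (toStr P) 2 ≤-refl
      toStr-isSatMod P = functional⇒model F , functional⇒saturated F
        where
        F : Functional (toStr P)
        F = toStr-functional P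

    SatMod⇒PreCat : SatMod tr 2 ≤-refl 𝕋cat ℓ → PreCat ℓ
    SatMod⇒PreCat X = toPreCat (SatMod⇒functional X)

    PreCat⇒SatMod : PreCat ℓ → SatMod tr 2 ≤-refl 𝕋cat ℓ
    PreCat⇒SatMod P = toStr P , toStr-isSatMod P

    SatMod⇒PreCat-isEquiv : isEquiv (SatMod⇒PreCat {ℓ})
    SatMod⇒PreCat-isEquiv = isEquiv-inverse SatMod⇒PreCat PreCat⇒SatMod
      (λ P → toPreCat-toStr P (SatMod⇒functional (PreCat⇒SatMod P)))
      (λ X → SatMod-≡ tr {X = PreCat⇒SatMod (SatMod⇒PreCat X)} {Y = X}
                         (toStr-toPreCat (SatMod⇒functional X)))

proposition4p10 : (∀ ℓ → Univalence ℓ) → (tr : PropTrunc) →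
    ∀ (ℓ : Level) → SatMod tr 2 ≤-refl 𝕋cat ℓ ≃ PreCat ℓ
proposition4p10 ua tr ℓ = SatMod⇒PreCat tr , SatMod⇒PreCat-isEquiv tr
  where open FromUnivalence ua
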